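{- $A(\mathbb{N},2)=3$, i.e. $\lim_{n\to\infty}A(n,2)=3$.
   Context: For a homogeneous $g\in\mathbb{C}[x_1,\ldots,x_n]_d$, the Waring rank $\mathbf{R}(g)$ is the minimum $r$ such that $g=\ell_1^d+\cdots+\ell_r^d$ for some complex linear forms $\ell_i$. $A(n,d)$ is the minimum of $\mathbf{R}(g)$ over all $g\in\mathbb{C}[x_1,\ldots,x_n]_d$ whose set of monomials with nonzero coefficient is exactly the set of all multilinear monomials $x_{i_1}\cdots x_{i_d}$, $1\le i_1<\cdots<i_d\le n$. $A(\mathbb{N},d):=\lim_{n\to\infty}A(n,d)$. -}

module Defs where

open import Algebra.Bundles using (CommutativeRing; RawSemiring; Semiring)
import Algebra.Definitions.RawSemiring as RawSemiringOps
open import Data.Fin.Base using (Fin; toℕ)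
open import Data.Integer.Base using (+_)
open import Data.Nat.Base as ℕ using (ℕ; zero; suc; _∸_; _⊔_)
import Data.Nat.Properties as ℕ
open import Data.Product.Base using (Σ; ∃; _×_; _,_; proj₁; proj₂)
open import Data.Rational.Base as ℚ using (ℚ; 0ℚ; 1ℚ; ½; ∣_∣)
import Data.Rational.Properties as ℚ
open import Data.Rational.Solver using (module +-*-Solver)
open import Data.Vec.Base as Vec using (Vec; []; _∷_)
open import Data.Vec.Relation.Unary.All using (All)
open import Function.Bundles using (_⇔_)
open import Level using (0ℓ)
open import Relation.Binary.PropositionalEquality
  using (_≡_; _≢_; _≗_; refl; sym; trans; cong; cong₂; subst; subst₂)
open import Relation.Nullary using (¬_)

------------------------------------------------------------------------
-- Real numbers

infix 4 _∼_

-- For Cauchy sequences x and y this says that x m - y m tends to 0;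
-- for y = x it says that x is a Cauchy sequence.
_∼_ : (ℕ → ℚ) → (ℕ → ℚ) → Set
x ∼ y = ∀ ε → 0ℚ ℚ.< ε →
  ∃ λ N → ∀ m n → N ℕ.≤ m → N ℕ.≤ n → ∣ x m ℚ.- y n ∣ ℚ.< ε

Cauchy : (ℕ → ℚ) → Set
Cauchy x = x ∼ x

private

  abstract

    half-pos : ∀ {ε} → 0ℚ ℚ.< ε → 0ℚ ℚ.< ½ ℚ.* ε
    half-pos {ε} 0<ε =
      subst (ℚ._< ½ ℚ.* ε) (ℚ.*-zeroʳ ½) (ℚ.*-monoʳ-<-pos ½ 0<ε)

    half+half : ∀ ε → ½ ℚ.* ε ℚ.+ ½ ℚ.* ε ≡ ε
    half+half ε =
      trans (sym (ℚ.*-distribʳ-+ ε ½ ½)) (ℚ.*-identityˡ ε)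

    ∣p-q∣≡∣q-p∣ : ∀ p q → ∣ p ℚ.- q ∣ ≡ ∣ q ℚ.- p ∣
    ∣p-q∣≡∣q-p∣ p q = trans (sym (ℚ.∣-p∣≡∣p∣ (p ℚ.- q))) (cong ∣_∣
      (+-*-Solver.solve 2 (λ p q → (:- (p :- q)) := (q :- p)) refl p q))
      where open +-*-Solver

    triangle : ∀ a b c {ε δ} → ∣ a ℚ.- b ∣ ℚ.< ε → ∣ b ℚ.- c ∣ ℚ.< δ →
               ∣ a ℚ.- c ∣ ℚ.< ε ℚ.+ δ
    triangle a b c p q =
      subst (λ t → ∣ t ∣ ℚ.< _)
        (+-*-Solver.solve 3
          (λ a b c → ((a :- b) :+ (b :- c)) := (a :- c)) refl a b c)
        (ℚ.≤-<-trans (ℚ.∣p+q∣≤∣p∣+∣q∣ (a ℚ.- b) (b ℚ.- c))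
          (ℚ.+-mono-< p q))
      where open +-*-Solver

    ∼-sym : ∀ {x y} → x ∼ y → y ∼ x
    ∼-sym {x} {y} x∼y ε 0<ε with x∼y ε 0<ε
    ... | N , H = N , λ m n N≤m N≤n →
      subst (ℚ._< ε) (∣p-q∣≡∣q-p∣ (x n) (y m)) (H n m N≤n N≤m)

    ∼-trans : ∀ {x y z} → x ∼ y → y ∼ z → x ∼ z
    ∼-trans {x} {y} {z} x∼y y∼z ε 0<ε
      with x∼y (½ ℚ.* ε) (half-pos 0<ε) | y∼z (½ ℚ.* ε) (half-pos 0<ε)
    ... | M , H | N , K = M ⊔ N , λ m n M⊔N≤m M⊔N≤n →
      subst (_ ℚ.<_) (half+half ε)
        (triangle (x m) (y (M ⊔ N)) (z n)
          (H m (M ⊔ N) (ℕ.m⊔n≤o⇒m≤o M N M⊔N≤m) (ℕ.m≤m⊔n M N))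
          (K (M ⊔ N) n (ℕ.m≤n⊔m M N) (ℕ.m⊔n≤o⇒n≤o M N M⊔N≤n)))

    ∼-resp-≗ : ∀ {x x′ y y′} → x ≗ x′ → y ≗ y′ → x ∼ y → x′ ∼ y′
    ∼-resp-≗ x≗x′ y≗y′ x∼y ε 0<ε with x∼y ε 0<ε
    ... | N , H = N , λ m n N≤m N≤n →
      subst₂ (λ s t → ∣ s ℚ.- t ∣ ℚ.< ε) (x≗x′ m) (y≗y′ n) (H m n N≤m N≤n)

    ∼-const : ∀ q → (λ _ → q) ∼ (λ _ → q)
    ∼-const q ε 0<ε = 0 , λ _ _ _ _ →
      subst (λ t → ∣ t ∣ ℚ.< ε) (sym (ℚ.+-inverseʳ q)) 0<ε

    ∼-+ : ∀ {x x′ y y′} → x ∼ x′ → y ∼ y′ →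
          (λ n → x n ℚ.+ y n) ∼ (λ n → x′ n ℚ.+ y′ n)
    ∼-+ {x} {x′} {y} {y′} x∼x′ y∼y′ ε 0<ε
      with x∼x′ (½ ℚ.* ε) (half-pos 0<ε) | y∼y′ (½ ℚ.* ε) (half-pos 0<ε)
    ... | M , H | N , K = M ⊔ N , λ m n M⊔N≤m M⊔N≤n →
      subst₂ (λ s t → ∣ s ∣ ℚ.< t)
        (+-*-Solver.solve 4
          (λ a b c d → ((a :- b) :+ (c :- d)) := ((a :+ c) :- (b :+ d)))
          refl (x m) (x′ n) (y m) (y′ n))
        (half+half ε)
        (ℚ.≤-<-trans (ℚ.∣p+q∣≤∣p∣+∣q∣ (x m ℚ.- x′ n) (y m ℚ.- y′ n))
          (ℚ.+-mono-<
            (H m n (ℕ.m⊔n≤o⇒m≤o M N M⊔N≤m) (ℕ.m⊔n≤o⇒m≤o M N M⊔N≤n))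
            (K m n (ℕ.m⊔n≤o⇒n≤o M N M⊔N≤m) (ℕ.m⊔n≤o⇒n≤o M N M⊔N≤n))))
      where open +-*-Solver

    ∼-neg : ∀ {x x′} → x ∼ x′ → (λ n → ℚ.- x n) ∼ (λ n → ℚ.- x′ n)
    ∼-neg {x} {x′} x∼x′ ε 0<ε with x∼x′ ε 0<ε
    ... | N , H = N , λ m n N≤m N≤n →
      subst (ℚ._< ε)
        (trans (sym (ℚ.∣-p∣≡∣p∣ (x m ℚ.- x′ n)))
          (cong ∣_∣ (ℚ.neg-distrib-+ (x m) (ℚ.- x′ n))))
        (H m n N≤m N≤n)

    0<1 : 0ℚ ℚ.< 1ℚ
    0<1 = ℚ.positive⁻¹ 1ℚ

    bounded : ∀ {x x′} → x ∼ x′ → ∃ λ B → 0ℚ ℚ.< B ×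
              ∃ λ N → ∀ m → N ℕ.≤ m → ∣ x m ∣ ℚ.< B
    bounded {x} {x′} x∼x′ with x∼x′ 1ℚ 0<1
    ... | N , H = 1ℚ ℚ.+ ∣ x′ N ∣
      , ℚ.+-mono-<-≤ 0<1 (ℚ.0≤∣p∣ (x′ N))
      , N , λ m N≤m →
        ℚ.≤-<-trans
          (subst (λ t → ∣ t ∣ ℚ.≤ ∣ x m ℚ.- x′ N ∣ ℚ.+ ∣ x′ N ∣)
            (+-*-Solver.solve 2 (λ a b → ((a :- b) :+ b) := a)
              refl (x m) (x′ N))
            (ℚ.∣p+q∣≤∣p∣+∣q∣ (x m ℚ.- x′ N) (x′ N)))
          (ℚ.+-mono-<-≤ (H m N N≤m ℕ.≤-refl) ℚ.≤-refl)
      where open +-*-Solver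

    divide : ∀ {B ε} → 0ℚ ℚ.< B → 0ℚ ℚ.< ε →
             ∃ λ δ → 0ℚ ℚ.< δ × B ℚ.* δ ≡ ε
    divide {B} {ε} 0<B 0<ε =
      1/B ℚ.* ε
      , ℚ.positive⁻¹ (1/B ℚ.* ε)
          {{ℚ.pos*pos⇒pos 1/B {{ℚ.1/pos⇒pos B}} ε {{ℚ.positive 0<ε}}}}
      , trans (sym (ℚ.*-assoc B 1/B ε))
          (trans (cong (ℚ._* ε) (ℚ.*-inverseʳ B)) (ℚ.*-identityˡ ε))
      where
      instance
        B-positive : ℚ.Positive B
        B-positive = ℚ.positive 0<B
        B-nonZero : ℚ.NonZero B
        B-nonZero = ℚ.pos⇒nonZero B
      1/B : ℚ
      1/B = ℚ.1/ B

    mul-bound : ∀ {B δ ε} a b → 0ℚ ℚ.< B → B ℚ.* δ ≡ ε →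
                ∣ a ∣ ℚ.< B → ∣ b ∣ ℚ.< δ → ∣ a ℚ.* b ∣ ℚ.< ε
    mul-bound {B} a b 0<B B*δ≡ε a<B b<δ =
      subst₂ ℚ._<_ (sym (ℚ.∣p*q∣≡∣p∣*∣q∣ a b)) B*δ≡ε
        (ℚ.≤-<-trans
          (ℚ.*-monoʳ-≤-nonNeg ∣ b ∣ {{ℚ.nonNegative (ℚ.0≤∣p∣ b)}}
            (ℚ.<⇒≤ a<B))
          (ℚ.*-monoʳ-<-pos B {{ℚ.positive 0<B}} b<δ))

    product-difference : ∀ a b c d →
      a ℚ.* (c ℚ.- d) ℚ.+ d ℚ.* (a ℚ.- b) ≡ a ℚ.* c ℚ.- b ℚ.* d
    product-difference = +-*-Solver.solve 4
      (λ a b c d →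
        ((a :* (c :- d)) :+ (d :* (a :- b))) := ((a :* c) :- (b :* d)))
      refl
      where open +-*-Solver

    product-close : ∀ {ε} a b c d →
      ∣ a ℚ.* (c ℚ.- d) ∣ ℚ.< ½ ℚ.* ε → ∣ d ℚ.* (a ℚ.- b) ∣ ℚ.< ½ ℚ.* ε →
      ∣ a ℚ.* c ℚ.- b ℚ.* d ∣ ℚ.< ε
    product-close {ε} a b c d p q =
      subst₂ (λ s t → ∣ s ∣ ℚ.< t)
        (product-difference a b c d) (half+half ε)
        (ℚ.≤-<-trans
          (ℚ.∣p+q∣≤∣p∣+∣q∣ (a ℚ.* (c ℚ.- d)) (d ℚ.* (a ℚ.- b)))
          (ℚ.+-mono-< p q))

    ∼-* : ∀ {x x′ y y′} → x ∼ x′ → y ∼ y′ →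
          (λ n → x n ℚ.* y n) ∼ (λ n → x′ n ℚ.* y′ n)
    ∼-* {x} {x′} {y} {y′} x∼x′ y∼y′ ε 0<ε =
      let B , 0<B , M₁ , H₁ = bounded x∼x′
          C , 0<C , M₂ , H₂ = bounded (∼-sym {y} {y′} y∼y′)
          δ , 0<δ , B*δ = divide 0<B (half-pos 0<ε)
          η , 0<η , C*η = divide 0<C (half-pos 0<ε)
          N₁ , K₁ = x∼x′ η 0<η
          N₂ , K₂ = y∼y′ δ 0<δ
          M = M₁ ⊔ M₂
          N = N₁ ⊔ N₂
      in M ⊔ N , λ m n ≤m ≤n →
        let M≤m = ℕ.m⊔n≤o⇒m≤o M N ≤m
            M≤n = ℕ.m⊔n≤o⇒m≤o M N ≤n
            N≤m = ℕ.m⊔n≤o⇒n≤o M N ≤m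
            N≤n = ℕ.m⊔n≤o⇒n≤o M N ≤n
        in product-close (x m) (x′ n) (y m) (y′ n)
             (mul-bound (x m) (y m ℚ.- y′ n) 0<B B*δ
               (H₁ m (ℕ.m⊔n≤o⇒m≤o M₁ M₂ M≤m))
               (K₂ m n (ℕ.m⊔n≤o⇒n≤o N₁ N₂ N≤m) (ℕ.m⊔n≤o⇒n≤o N₁ N₂ N≤n)))
             (mul-bound (y′ n) (x m ℚ.- x′ n) 0<C C*η
               (H₂ n (ℕ.m⊔n≤o⇒n≤o M₁ M₂ M≤n))
               (K₁ m n (ℕ.m⊔n≤o⇒m≤o N₁ N₂ N≤m) (ℕ.m⊔n≤o⇒m≤o N₁ N₂ N≤n)))

record ℝ : Set where
  constructor mkℝ
  field
    seq    : ℕ → ℚ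
    cauchy : Cauchy seq

open ℝ public

infix 4 _≈ℝ_

record _≈ℝ_ (x y : ℝ) : Set where
  constructor mk≈
  field seq-∼ : seq x ∼ seq y

open _≈ℝ_ public

fromℚ : ℚ → ℝ
fromℚ q = mkℝ (λ _ → q) (∼-const q)

infixl 6 _+ℝ_
infixl 7 _*ℝ_
infix  8 -ℝ_

_+ℝ_ : ℝ → ℝ → ℝ
x +ℝ y = mkℝ (λ n → seq x n ℚ.+ seq y n)
  (∼-+ {seq x} {seq x} {seq y} {seq y} (cauchy x) (cauchy y))

_*ℝ_ : ℝ → ℝ → ℝ
x *ℝ y = mkℝ (λ n → seq x n ℚ.* seq y n)
  (∼-* {seq x} {seq x} {seq y} {seq y} (cauchy x) (cauchy y))

-ℝ_ : ℝ → ℝ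
-ℝ x = mkℝ (λ n → ℚ.- seq x n) (∼-neg {seq x} {seq x} (cauchy x))

≗⇒≈ℝ : ∀ {x y} → seq x ≗ seq y → x ≈ℝ y
≗⇒≈ℝ {x} {y} x≗y =
  mk≈ (∼-resp-≗ {seq x} {seq x} {seq x} {seq y} (λ _ → refl) x≗y (cauchy x))

ℝ-commutativeRing : CommutativeRing 0ℓ 0ℓ
ℝ-commutativeRing = record
  { Carrier = ℝ
  ; _≈_ = _≈ℝ_
  ; _+_ = _+ℝ_
  ; _*_ = _*ℝ_
  ; -_ = -ℝ_
  ; 0# = fromℚ 0ℚ
  ; 1# = fromℚ 1ℚ
  ; isCommutativeRing = record
    { isRing = record
      { +-isAbelianGroup = record
        { isGroup = record
          { isMonoid = record
            { isSemigroup = record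
              { isMagma = record
                { isEquivalence = record
                  { refl = λ {x} → mk≈ (cauchy x)
                  ; sym = λ {x} {y} p →
                      mk≈ (∼-sym {seq x} {seq y} (seq-∼ p))
                  ; trans = λ {x} {y} {z} p q →
                      mk≈ (∼-trans {seq x} {seq y} {seq z}
                        (seq-∼ p) (seq-∼ q))
                  }
                ; ∙-cong = λ {x} {x′} {y} {y′} p q →
                    mk≈ (∼-+ {seq x} {seq x′} {seq y} {seq y′}
                      (seq-∼ p) (seq-∼ q))
                }
              ; assoc = λ x y z →
                  ≗⇒≈ℝ λ n → ℚ.+-assoc (seq x n) (seq y n) (seq z n)
              }
            ; identity = (λ x → ≗⇒≈ℝ λ n → ℚ.+-identityˡ (seq x n))
                       , (λ x → ≗⇒≈ℝ λ n → ℚ.+-identityʳ (seq x n))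
            }
          ; inverse = (λ x → ≗⇒≈ℝ λ n → ℚ.+-inverseˡ (seq x n))
                    , (λ x → ≗⇒≈ℝ λ n → ℚ.+-inverseʳ (seq x n))
          ; ⁻¹-cong = λ {x} {y} p →
              mk≈ (∼-neg {seq x} {seq y} (seq-∼ p))
          }
        ; comm = λ x y → ≗⇒≈ℝ λ n → ℚ.+-comm (seq x n) (seq y n)
        }
      ; *-cong = λ {x} {x′} {y} {y′} p q →
          mk≈ (∼-* {seq x} {seq x′} {seq y} {seq y′} (seq-∼ p) (seq-∼ q))
      ; *-assoc = λ x y z →
          ≗⇒≈ℝ λ n → ℚ.*-assoc (seq x n) (seq y n) (seq z n)
      ; *-identity = (λ x → ≗⇒≈ℝ λ n → ℚ.*-identityˡ (seq x n))
                   , (λ x → ≗⇒≈ℝ λ n → ℚ.*-identityʳ (seq x n))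
      ; distrib = (λ x y z →
                    ≗⇒≈ℝ λ n → ℚ.*-distribˡ-+ (seq x n) (seq y n) (seq z n))
                , (λ x y z →
                    ≗⇒≈ℝ λ n → ℚ.*-distribʳ-+ (seq x n) (seq y n) (seq z n))
      }
    ; *-comm = λ x y → ≗⇒≈ℝ λ n → ℚ.*-comm (seq x n) (seq y n)
    }
  }

------------------------------------------------------------------------
-- Complex numbers

infix 4 _≈ℂ_
infixl 6 _+ℂ_
infixl 7 _*ℂ_
infix  8 -ℂ_

record ℂ : Set where
  constructor _+i_
  field
    re im : ℝ

open ℂ public

record _≈ℂ_ (z w : ℂ) : Set where
  constructor _,_
  field
    re-≈ : re z ≈ℝ re w
    im-≈ : im z ≈ℝ im w

open _≈ℂ_ public

0ℂ 1ℂ : ℂ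
0ℂ = fromℚ 0ℚ +i fromℚ 0ℚ
1ℂ = fromℚ 1ℚ +i fromℚ 0ℚ

_+ℂ_ _*ℂ_ : ℂ → ℂ → ℂ
(a +i b) +ℂ (c +i d) = (a +ℝ c) +i (b +ℝ d)
(a +i b) *ℂ (c +i d) = (a *ℝ c +ℝ -ℝ (b *ℝ d)) +i (a *ℝ d +ℝ b *ℝ c)

-ℂ_ : ℂ → ℂ
-ℂ (a +i b) = (-ℝ a) +i (-ℝ b)

private

  module ℚ-Laws where

    open import Data.Rational.Base using (_+_; _-_; _*_)
    open +-*-Solver using (con; _:+_; _:-_; _:*_; _:=_)

    abstract

      assoc-re : ∀ a b c d e f →
        (a * c - b * d) * e - (a * d + b * c) * f ≡
        a * (c * e - d * f) - b * (c * f + d * e)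
      assoc-re = +-*-Solver.solve 6 (λ a b c d e f →
        ((a :* c :- b :* d) :* e :- (a :* d :+ b :* c) :* f) :=
        (a :* (c :* e :- d :* f) :- b :* (c :* f :+ d :* e))) refl

      assoc-im : ∀ a b c d e f →
        (a * c - b * d) * f + (a * d + b * c) * e ≡
        a * (c * f + d * e) + b * (c * e - d * f)
      assoc-im = +-*-Solver.solve 6 (λ a b c d e f →
        ((a :* c :- b :* d) :* f :+ (a :* d :+ b :* c) :* e) :=
        (a :* (c :* f :+ d :* e) :+ b :* (c :* e :- d :* f))) refl

      comm-re : ∀ a b c d →
        a * c - b * d ≡
        c * a - d * b
      comm-re = +-*-Solver.solve 4 (λ a b c d →
        (a :* c :- b :* d) :=
        (c :* a :- d :* b)) refl

      comm-im : ∀ a b c d →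
        a * d + b * c ≡
        c * b + d * a
      comm-im = +-*-Solver.solve 4 (λ a b c d →
        (a :* d :+ b :* c) :=
        (c :* b :+ d :* a)) refl

      identity-re : ∀ a b →
        1ℚ * a - 0ℚ * b ≡
        a
      identity-re = +-*-Solver.solve 2 (λ a b →
        (con 1ℚ :* a :- con 0ℚ :* b) :=
        (a)) refl

      identity-im : ∀ a b →
        1ℚ * b + 0ℚ * a ≡
        b
      identity-im = +-*-Solver.solve 2 (λ a b →
        (con 1ℚ :* b :+ con 0ℚ :* a) :=
        (b)) refl

      distrib-re : ∀ a b c d e f →
        a * (c + e) - b * (d + f) ≡
        (a * c - b * d) + (a * e - b * f)
      distrib-re = +-*-Solver.solve 6 (λ a b c d e f →
        (a :* (c :+ e) :- b :* (d :+ f)) :=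
        ((a :* c :- b :* d) :+ (a :* e :- b :* f))) refl

      distrib-im : ∀ a b c d e f →
        a * (d + f) + b * (c + e) ≡
        (a * d + b * c) + (a * f + b * e)
      distrib-im = +-*-Solver.solve 6 (λ a b c d e f →
        (a :* (d :+ f) :+ b :* (c :+ e)) :=
        ((a :* d :+ b :* c) :+ (a :* f :+ b :* e))) refl

  module R = CommutativeRing ℝ-commutativeRing
  module L = ℚ-Laws

  *ℂ-comm : ∀ z w → z *ℂ w ≈ℂ w *ℂ z
  *ℂ-comm (a +i b) (c +i d) =
    (≗⇒≈ℝ λ n → L.comm-re
      (seq a n) (seq b n) (seq c n) (seq d n)) ,
    (≗⇒≈ℝ λ n → L.comm-im
      (seq a n) (seq b n) (seq c n) (seq d n))

  *ℂ-identityˡ : ∀ z → 1ℂ *ℂ z ≈ℂ z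
  *ℂ-identityˡ (a +i b) =
    (≗⇒≈ℝ λ n → L.identity-re
      (seq a n) (seq b n)) ,
    (≗⇒≈ℝ λ n → L.identity-im
      (seq a n) (seq b n))

  *ℂ-distribˡ : ∀ z w v → z *ℂ (w +ℂ v) ≈ℂ z *ℂ w +ℂ z *ℂ v
  *ℂ-distribˡ (a +i b) (c +i d) (e +i f) =
    (≗⇒≈ℝ λ n → L.distrib-re
      (seq a n) (seq b n) (seq c n) (seq d n) (seq e n) (seq f n)) ,
    (≗⇒≈ℝ λ n → L.distrib-im
      (seq a n) (seq b n) (seq c n) (seq d n) (seq e n) (seq f n))

  *ℂ-assoc : ∀ z w v → (z *ℂ w) *ℂ v ≈ℂ z *ℂ (w *ℂ v)
  *ℂ-assoc (a +i b) (c +i d) (e +i f) =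
    (≗⇒≈ℝ λ n → L.assoc-re
      (seq a n) (seq b n) (seq c n) (seq d n) (seq e n) (seq f n)) ,
    (≗⇒≈ℝ λ n → L.assoc-im
      (seq a n) (seq b n) (seq c n) (seq d n) (seq e n) (seq f n))

  ≈ℂ-trans : ∀ {z w v} → z ≈ℂ w → w ≈ℂ v → z ≈ℂ v
  ≈ℂ-trans (p , q) (p′ , q′) = R.trans p p′ , R.trans q q′

  +ℂ-cong : ∀ {z z′ w w′} → z ≈ℂ z′ → w ≈ℂ w′ → z +ℂ w ≈ℂ z′ +ℂ w′
  +ℂ-cong (p , q) (p′ , q′) = R.+-cong p p′ , R.+-cong q q′

ℂ-commutativeRing : CommutativeRing 0ℓ 0ℓ
ℂ-commutativeRing = record
  { Carrier = ℂ
  ; _≈_ = _≈ℂ_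
  ; _+_ = _+ℂ_
  ; _*_ = _*ℂ_
  ; -_ = -ℂ_
  ; 0# = 0ℂ
  ; 1# = 1ℂ
  ; isCommutativeRing = record
    { isRing = record
      { +-isAbelianGroup = record
        { isGroup = record
          { isMonoid = record
            { isSemigroup = record
              { isMagma = record
                { isEquivalence = record
                  { refl = R.refl , R.refl
                  ; sym = λ (p , q) → R.sym p , R.sym q
                  ; trans = ≈ℂ-trans
                  }
                ; ∙-cong = +ℂ-cong
                }
              ; assoc = λ z w v →
                  R.+-assoc (re z) (re w) (re v) ,
                  R.+-assoc (im z) (im w) (im v)
              }
            ; identity =
                (λ z → R.+-identityˡ (re z) , R.+-identityˡ (im z)) ,
                (λ z → R.+-identityʳ (re z) , R.+-identityʳ (im z))
            }
          ; inverse =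
              (λ z → R.-‿inverseˡ (re z) , R.-‿inverseˡ (im z)) ,
              (λ z → R.-‿inverseʳ (re z) , R.-‿inverseʳ (im z))
          ; ⁻¹-cong = λ (p , q) → R.-‿cong p , R.-‿cong q
          }
        ; comm = λ z w → R.+-comm (re z) (re w) , R.+-comm (im z) (im w)
        }
      ; *-cong = λ (p , q) (p′ , q′) →
          R.+-cong (R.*-cong p p′) (R.-‿cong (R.*-cong q q′)) ,
          R.+-cong (R.*-cong p q′) (R.*-cong q p′)
      ; *-assoc = *ℂ-assoc
      ; *-identity =
          *ℂ-identityˡ ,
          (λ z → ≈ℂ-trans (*ℂ-comm z 1ℂ) (*ℂ-identityˡ z))
      ; distrib =
          *ℂ-distribˡ ,
          (λ z w v → ≈ℂ-trans (*ℂ-comm (w +ℂ v) z)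
            (≈ℂ-trans (*ℂ-distribˡ z w v)
              (+ℂ-cong (*ℂ-comm z w) (*ℂ-comm z v))))
      }
    ; *-comm = *ℂ-comm
    }
  }

------------------------------------------------------------------------
-- Homogeneous polynomials

-- The exponent vector (α₁ , … , αₙ) stands for x₁^α₁ ⋯ xₙ^αₙ.
Monomial : ℕ → Set
Monomial n = Vec ℕ n

-- Families of coefficients indexed by all monomials, that is, formal power
-- series in n variables.  The polynomials among them are those with finite
-- support; this is automatic for homogeneous series, and only these are
-- used below.
module Series {c ℓ} (K : CommutativeRing c ℓ) where

  open CommutativeRing K
    using (Carrier; _≈_; _+_; _*_; 0#; 1#; semiring)
  open RawSemiringOps (Semiring.rawSemiring semiring) using (sum)

  Coefficients : ℕ → Set c
  Coefficients n = Monomial n → Carrier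

  -- (f ⋆ g) α = Σ f β * g γ over all β, γ with β + γ = α, the summation
  -- being carried out one variable at a time.
  _⋆_ : ∀ {n} → Coefficients n → Coefficients n → Coefficients n
  (f ⋆ g) []      = f [] * g []
  (f ⋆ g) (a ∷ α) = sum {suc a} λ i →
    ((λ β → f (toℕ i ∷ β)) ⋆ (λ γ → g ((a ∸ toℕ i) ∷ γ))) α

  one : ∀ {n} → Coefficients n
  one []          = 1#
  one (zero  ∷ α) = one α
  one (suc _ ∷ α) = 0#

  series : ℕ → RawSemiring c ℓ
  series n = record
    { Carrier = Coefficients n
    ; _≈_ = λ f g → ∀ α → f α ≈ g α
    ; _+_ = λ f g α → f α + g α
    ; _*_ = _⋆_
    ; 0# = λ _ → 0#
    ; 1# = one
    }

  Homogeneous : ∀ {n} → ℕ → Coefficients n → Set ℓ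
  Homogeneous d f = ∀ α → Vec.sum α ≢ d → f α ≈ 0#

open Series ℂ-commutativeRing public

record Form (n d : ℕ) : Set where
  constructor form
  field
    coeff       : Coefficients n
    homogeneous : Homogeneous d coeff

open Form public

LinearForm : ℕ → Set
LinearForm n = Form n 1

------------------------------------------------------------------------
-- Waring rank

IsSumOfPowers : ∀ {n d} → Form n d → ℕ → Set
IsSumOfPowers {n} {d} g r =
  Σ (Fin r → LinearForm n) λ l → coeff g ≈ sum (λ i → coeff (l i) ^ d)
  where
  open RawSemiring (series n) using (_≈_)
  open RawSemiringOps (series n) using (sum; _^_)

IsMinimum : (ℕ → Set) → ℕ → Set
IsMinimum P m = P m × (∀ k → P k → m ℕ.≤ k)

IsWaringRank : ∀ {n d} → Form n d → ℕ → Set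
IsWaringRank g = IsMinimum (IsSumOfPowers g)

IsMultilinear : ∀ {n} → ℕ → Monomial n → Set
IsMultilinear d α = All (ℕ._≤ 1) α × Vec.sum α ≡ d

HasMultilinearSupport : ∀ {n d} → Form n d → Set
HasMultilinearSupport {d = d} g =
  ∀ α → (¬ (coeff g α ≈ℂ 0ℂ)) ⇔ IsMultilinear d α

-- IsA n d a: the number A(n, d) equals a.
IsA : ℕ → ℕ → ℕ → Set
IsA n d = IsMinimum λ r →
  Σ (Form n d) λ g → HasMultilinearSupport g × IsWaringRank g r

------------------------------------------------------------------------
-- Limits

toℚ : ℕ → ℚ
toℚ k = (+ k) ℚ./ 1

infix 4 _⟶_

_⟶_ : (ℕ → ℕ) → ℕ → Set
a ⟶ L = ∀ ε → 0ℚ ℚ.< ε →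
  ∃ λ N → ∀ n → N ℕ.≤ n → ∣ toℚ (a n) ℚ.- toℚ L ∣ ℚ.< ε

-- A(n, d) is well defined for every n and tends to L as n → ∞.
A[ℕ,_]≡_ : ℕ → ℕ → Set
A[ℕ, d ]≡ L = Σ (ℕ → ℕ) λ a → (∀ n → IsA n d (a n)) × a ⟶ L

module Submission where

-- Squares of linear forms ℓ₁ , … , ℓᵣ sum to a quadric whose coefficients
-- are read off the vectors vᵢ ∈ ℂʳ of coefficients of xᵢ: the support is
-- multilinear exactly when all vᵢ are isotropic for the standard bilinear
-- form and pairwise non-orthogonal.  Three such vectors cannot lie in ℂ²,
-- since their Gram determinant would be twice the product of the pairwise
-- products; in ℂ³ there are arbitrarily many, namely the points
-- (1 - t² , 2t , i(1 + t²)) of a conic, whose products are -2(s - t)².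

import Algebra.Definitions.RawSemiring as RawSemiringOps
import Algebra.Properties.CommutativeSemigroup as CommutativeSemigroupProperties
import Algebra.Properties.Group as GroupProperties
import Algebra.Properties.Monoid.Sum as MonoidSum
import Algebra.Solver.Ring.NaturalCoefficients.Default as NaturalSolver
open import Algebra.Bundles using (CommutativeRing)
open import Data.Fin.Base using (Fin; zero; suc; toℕ)
import Data.Fin.Properties as Fin
import Data.Integer.Base as ℤ
import Data.Integer.Properties as ℤ
open import Data.Nat.Base as ℕ using (ℕ; zero; suc; z≤n; s≤s)
import Data.Nat.Properties as ℕ
open import Data.Product.Base using (∃; ∃₂; _×_; _,_; proj₁; proj₂)
open import Data.Rational.Base as ℚ using (ℚ; 0ℚ; 1ℚ; ∣_∣)
import Data.Rational.Properties as ℚ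
open import Data.Rational.Solver using (module +-*-Solver)
open import Data.Rational.Unnormalised.Base using (mkℚᵘ; *≡*)
open import Data.Sum.Base using (inj₁; inj₂)
open import Data.Vec.Base as Vec using ([]; _∷_; replicate; zipWith)
open import Data.Vec.Relation.Unary.All using (All; []; _∷_)
open import Function.Base using (_∘_)
open import Function.Bundles using (mk⇔; module Equivalence)
open import Relation.Binary.PropositionalEquality
  using (_≡_; _≢_; refl; sym; trans; cong; cong₂; subst)
open import Relation.Nullary using (¬_; yes; no; contradiction)

open import Defs hiding (_⋆_; one; series; Coefficients; Homogeneous)

-- Monomials of degree at most two.

𝟎 : ∀ {n} → Monomial n
𝟎 = replicate _ 0

single : ∀ {n} → Fin n → Monomial n
single zero    = 1 ∷ 𝟎
single (suc i) = 0 ∷ single i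

-- The exponent vector of x_i x_j, a square when i = j. Recursion on both indices, instead of adding
-- two `single` vectors, lets the coefficients of a `⋆` product unfold along it one variable at a
-- time.
pair : ∀ {n} → Fin n → Fin n → Monomial n
pair zero    zero    = 2 ∷ 𝟎
pair zero    (suc j) = 1 ∷ single j
pair (suc i) zero    = 1 ∷ single i
pair (suc i) (suc j) = 0 ∷ pair i j

sum-𝟎 : ∀ n → Vec.sum (𝟎 {n}) ≡ 0
sum-𝟎 zero    = refl
sum-𝟎 (suc n) = sum-𝟎 n

sum-single : ∀ {n} (i : Fin n) → Vec.sum (single i) ≡ 1
sum-single {suc n} zero    = cong suc (sum-𝟎 n)
sum-single         (suc i) = sum-single i

sum-pair : ∀ {n} (i j : Fin n) → Vec.sum (pair i j) ≡ 2
sum-pair {suc n} zero    zero    = cong (2 ℕ.+_) (sum-𝟎 n)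
sum-pair         zero    (suc j) = cong suc (sum-single j)
sum-pair         (suc i) zero    = cong suc (sum-single i)
sum-pair         (suc i) (suc j) = sum-pair i j

sum≡0⇒𝟎 : ∀ {n} (α : Monomial n) → Vec.sum α ≡ 0 → α ≡ 𝟎
sum≡0⇒𝟎 []         _  = refl
sum≡0⇒𝟎 (zero ∷ α) eq = cong (0 ∷_) (sum≡0⇒𝟎 α eq)

sum≡1⇒single : ∀ {n} (α : Monomial n) → Vec.sum α ≡ 1 → ∃ λ i → α ≡ single i
sum≡1⇒single (zero ∷ α) eq with i , refl ← sum≡1⇒single α eq = suc i , refl
sum≡1⇒single (suc zero ∷ α) eq =
  zero , cong (1 ∷_) (sum≡0⇒𝟎 α (ℕ.suc-injective eq))

sum≡2⇒pair : ∀ {n} (α : Monomial n) → Vec.sum α ≡ 2 → ∃₂ λ i j → α ≡ pair i j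
sum≡2⇒pair (zero ∷ α) eq with i , j , refl ← sum≡2⇒pair α eq =
  suc i , suc j , refl
sum≡2⇒pair (suc zero ∷ α) eq
  with j , refl ← sum≡1⇒single α (ℕ.suc-injective eq) = zero , suc j , refl
sum≡2⇒pair (suc (suc zero) ∷ α) eq =
  zero , zero ,
  cong (2 ∷_) (sum≡0⇒𝟎 α (ℕ.suc-injective (ℕ.suc-injective eq)))

𝟎≤1 : ∀ n → All (ℕ._≤ 1) (𝟎 {n})
𝟎≤1 zero    = []
𝟎≤1 (suc n) = z≤n ∷ 𝟎≤1 n

single≤1 : ∀ {n} (i : Fin n) → All (ℕ._≤ 1) (single i)
single≤1 zero    = s≤s z≤n ∷ 𝟎≤1 _
single≤1 (suc i) = z≤n ∷ single≤1 i

pair≤1 : ∀ {n} {i j : Fin n} → i ≢ j → All (ℕ._≤ 1) (pair i j)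
pair≤1 {i = zero}  {zero}  i≢j = contradiction refl i≢j
pair≤1 {i = zero}  {suc j} i≢j = s≤s z≤n ∷ single≤1 j
pair≤1 {i = suc i} {zero}  i≢j = s≤s z≤n ∷ single≤1 i
pair≤1 {i = suc i} {suc j} i≢j = z≤n ∷ pair≤1 (i≢j ∘ cong suc)

pair-diagonal≰1 : ∀ {n} (i : Fin n) → ¬ All (ℕ._≤ 1) (pair i i)
pair-diagonal≰1 zero    (s≤s () ∷ _)
pair-diagonal≰1 (suc i) (_ ∷ α≤1) = pair-diagonal≰1 i α≤1

sum-zipWith-+ : ∀ {n} (β γ : Monomial n) →
                Vec.sum (zipWith ℕ._+_ β γ) ≡ Vec.sum β ℕ.+ Vec.sum γ
sum-zipWith-+ []      []      = refl
sum-zipWith-+ (b ∷ β) (c ∷ γ) =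
  trans (cong (b ℕ.+ c ℕ.+_) (sum-zipWith-+ β γ))
    (interchange b c (Vec.sum β) (Vec.sum γ))
  where open CommutativeSemigroupProperties ℕ.+-commutativeSemigroup

-- Coefficients of products and of squares of linear forms.

module SeriesProperties {c ℓ} (K : CommutativeRing c ℓ) where

  open Series K
  open CommutativeRing K hiding (refl; sym; trans; zero)
  open CommutativeRing K using ()
    renaming (refl to ≈-refl; sym to ≈-sym; trans to ≈-trans)
  open MonoidSum +-monoid using (sum; sum-cong-≋; sum-replicate-zero)
  open NaturalSolver commutativeSemiring using (solve; _:+_; _:*_; _:=_; con)
  open import Relation.Binary.Reasoning.Setoid setoid

  sum-zero : ∀ {n} {t : Fin n → Carrier} → (∀ i → t i ≈ 0#) → sum t ≈ 0#
  sum-zero {n} t≈0 = ≈-trans (sum-cong-≋ t≈0) (sum-replicate-zero n)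

  zero-*ˡ : ∀ {x} y → x ≈ 0# → x * y ≈ 0#
  zero-*ˡ y x≈0 = ≈-trans (*-congʳ x≈0) (zeroˡ y)

  zero-*ʳ : ∀ x {y} → y ≈ 0# → x * y ≈ 0#
  zero-*ʳ x y≈0 = ≈-trans (*-congˡ y≈0) (zeroʳ x)

  zero-+ : ∀ {x y} → x ≈ 0# → y ≈ 0# → x + y ≈ 0#
  zero-+ x≈0 y≈0 = ≈-trans (+-cong x≈0 y≈0) (+-identityˡ 0#)

  slice : ∀ {n} → Coefficients (suc n) → ℕ → Coefficients n
  slice f a α = f (a ∷ α)

  -- Induction on the variables: every summand of the iterated convolution is some `f β * g γ` with
  -- β + γ = α.
  ⋆-vanish : ∀ {n} (f g : Coefficients n) α →
             (∀ β γ → zipWith ℕ._+_ β γ ≡ α → f β * g γ ≈ 0#) →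
             (f ⋆ g) α ≈ 0#
  ⋆-vanish f g []      fg≈0 = fg≈0 [] [] refl
  ⋆-vanish f g (a ∷ α) fg≈0 = sum-zero {suc a} λ i →
    ⋆-vanish (slice f (toℕ i)) (slice g (a ℕ.∸ toℕ i)) α
      λ β γ β+γ≡α → fg≈0 (toℕ i ∷ β) ((a ℕ.∸ toℕ i) ∷ γ)
        (cong₂ _∷_ (ℕ.m+[n∸m]≡n (Fin.toℕ≤pred[n] i)) β+γ≡α)

  -- Degrees add, so if β + γ = α and |α| ≠ d + e, then |β| ≠ d or |γ| ≠ e.
  ⋆-homogeneous : ∀ {n d e} {f g : Coefficients n} →
                  Homogeneous d f → Homogeneous e g →
                  Homogeneous (d ℕ.+ e) (f ⋆ g)
  ⋆-homogeneous {d = d} {e} {f} {g} hf hg α ∣α∣≢ = ⋆-vanish f g α vanish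
    where
    vanish : ∀ β γ → zipWith ℕ._+_ β γ ≡ α → f β * g γ ≈ 0#
    vanish β γ refl with Vec.sum β ℕ.≟ d | Vec.sum γ ℕ.≟ e
    ... | no ∣β∣≢d | _        = zero-*ˡ _ (hf β ∣β∣≢d)
    ... | yes _    | no ∣γ∣≢e = zero-*ʳ _ (hg γ ∣γ∣≢e)
    ... | yes refl | yes refl = contradiction (sum-zipWith-+ β γ) ∣α∣≢

  one-homogeneous : ∀ {n} → Homogeneous 0 (one {n})
  one-homogeneous []          ∣α∣≢0 = contradiction refl ∣α∣≢0
  one-homogeneous (zero  ∷ α) ∣α∣≢0 = one-homogeneous α ∣α∣≢0
  one-homogeneous (suc _ ∷ α) _     = ≈-refl

  one-𝟎 : ∀ n → one (𝟎 {n}) ≡ 1#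
  one-𝟎 zero    = refl
  one-𝟎 (suc n) = one-𝟎 n

  ⋆-𝟎 : ∀ {n} (f g : Coefficients n) → (f ⋆ g) 𝟎 ≈ f 𝟎 * g 𝟎
  ⋆-𝟎 {zero}  f g = ≈-refl
  -- A sum over `Fin 1` unfolds to its term plus a trailing `0#`, which `+-identityʳ` removes here
  -- and below.
  ⋆-𝟎 {suc n} f g = ≈-trans (+-identityʳ _) (⋆-𝟎 (slice f 0) (slice g 0))

  ⋆-single : ∀ {n} (f g : Coefficients n) i →
             (f ⋆ g) (single i) ≈ f 𝟎 * g (single i) + f (single i) * g 𝟎
  ⋆-single f g zero    =
    +-cong (⋆-𝟎 (slice f 0) (slice g 1))
      (≈-trans (+-identityʳ _) (⋆-𝟎 (slice f 1) (slice g 0)))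
  ⋆-single f g (suc i) =
    ≈-trans (+-identityʳ _) (⋆-single (slice f 0) (slice g 0) i)

  ⋆-pair-diagonal : ∀ {n} (f g : Coefficients n) i →
    (f ⋆ g) (pair i i) ≈
    f 𝟎 * g (pair i i) + f (single i) * g (single i) + f (pair i i) * g 𝟎
  ⋆-pair-diagonal f g zero    = ≈-trans
    (+-cong (⋆-𝟎 (slice f 0) (slice g 2))
      (+-cong (⋆-𝟎 (slice f 1) (slice g 1))
        (≈-trans (+-identityʳ _) (⋆-𝟎 (slice f 2) (slice g 0)))))
    (≈-sym (+-assoc _ _ _))
  ⋆-pair-diagonal f g (suc i) =
    ≈-trans (+-identityʳ _) (⋆-pair-diagonal (slice f 0) (slice g 0) i)

  -- For i ≠ j the monomial x_i x_j splits into linear factors in two ordered ways, for i = j in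
  -- only one; hence the separate `⋆-pair-diagonal`.
  ⋆-pair : ∀ {n} (f g : Coefficients n) {i j} → i ≢ j →
    (f ⋆ g) (pair i j) ≈
    f 𝟎 * g (pair i j)
      + (f (single i) * g (single j) + f (single j) * g (single i))
      + f (pair i j) * g 𝟎
  ⋆-pair f g {zero}  {zero}  i≢j = contradiction refl i≢j
  ⋆-pair f g {zero}  {suc j} i≢j = ≈-trans
    (+-cong (⋆-single (slice f 0) (slice g 1) j)
      (≈-trans (+-identityʳ _) (⋆-single (slice f 1) (slice g 0) j)))
    (solve 4 (λ p q r s → (p :+ q) :+ (r :+ s) := p :+ (r :+ q) :+ s)
      ≈-refl _ _ _ _)
  ⋆-pair f g {suc i} {zero}  i≢j = ≈-trans
    (+-cong (⋆-single (slice f 0) (slice g 1) i)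
      (≈-trans (+-identityʳ _) (⋆-single (slice f 1) (slice g 0) i)))
    (solve 4 (λ p q r s → (p :+ q) :+ (r :+ s) := p :+ (q :+ r) :+ s)
      ≈-refl _ _ _ _)
  ⋆-pair f g {suc i} {suc j} i≢j =
    ≈-trans (+-identityʳ _) (⋆-pair (slice f 0) (slice g 0) (i≢j ∘ cong suc))

  module _ {n : ℕ} where
    open RawSemiringOps (series n) public using (_^_) renaming (sum to sumˢ)

  sumˢ-pointwise : ∀ {n r} (F : Fin r → Coefficients n) α →
                   sumˢ F α ≡ sum λ k → F k α
  sumˢ-pointwise {r = zero}  F α = refl
  sumˢ-pointwise {r = suc r} F α = cong (_ +_) (sumˢ-pointwise (F ∘ suc) α)

  ^2-homogeneous : ∀ {n} {f : Coefficients n} →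
                   Homogeneous 1 f → Homogeneous 2 (f ^ 2)
  ^2-homogeneous hf = ⋆-homogeneous hf (⋆-homogeneous hf one-homogeneous)

  module _ {n} {f : Coefficients n} (hf : Homogeneous 1 f) where

    private

      f𝟎≈0 : f 𝟎 ≈ 0#
      f𝟎≈0 = hf 𝟎 λ eq → contradiction (trans (sym (sum-𝟎 n)) eq) λ ()

      fpair≈0 : ∀ i j → f (pair i j) ≈ 0#
      fpair≈0 i j = hf (pair i j) λ eq →
        contradiction (trans (sym (sum-pair i j)) eq) λ ()

      -- `f ^ 2` unfolds to `f ⋆ (f ⋆ one)`, so the trailing factor `one` has to be absorbed.
      ⋆one-single : ∀ i → (f ⋆ one) (single i) ≈ f (single i)
      ⋆one-single i = begin
        (f ⋆ one) (single i)
          ≈⟨ ⋆-single f one i ⟩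
        f 𝟎 * one (single i) + f (single i) * one (𝟎 {n})
          ≈⟨ +-cong (zero-*ˡ _ f𝟎≈0) (*-congˡ (reflexive (one-𝟎 n))) ⟩
        0# + f (single i) * 1#
          ≈⟨ +-identityˡ _ ⟩
        f (single i) * 1#
          ≈⟨ *-identityʳ _ ⟩
        f (single i) ∎

      -- The outer terms of `⋆-pair` and `⋆-pair-diagonal` carry a coefficient of `f` in degree 0 or
      -- 2, which is zero for a linear form.
      middle : ∀ {x y z} → x ≈ 0# → z ≈ 0# → x + y + z ≈ y
      middle x≈0 z≈0 = ≈-trans
        (+-cong (≈-trans (+-congʳ x≈0) (+-identityˡ _)) z≈0) (+-identityʳ _)

    ^2-pair-diagonal : ∀ i → (f ^ 2) (pair i i) ≈ f (single i) * f (single i)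
    ^2-pair-diagonal i = begin
      (f ^ 2) (pair i i)
        ≈⟨ ⋆-pair-diagonal f (f ⋆ one) i ⟩
      _ ≈⟨ middle (zero-*ˡ _ f𝟎≈0) (zero-*ˡ _ (fpair≈0 i i)) ⟩
      f (single i) * (f ⋆ one) (single i)
        ≈⟨ *-congˡ (⋆one-single i) ⟩
      f (single i) * f (single i) ∎

    ^2-pair : ∀ {i j} → i ≢ j → (f ^ 2) (pair i j) ≈
              f (single i) * f (single j) + f (single j) * f (single i)
    ^2-pair {i} {j} i≢j = begin
      (f ^ 2) (pair i j)
        ≈⟨ ⋆-pair f (f ⋆ one) i≢j ⟩
      _ ≈⟨ middle (zero-*ˡ _ f𝟎≈0) (zero-*ˡ _ (fpair≈0 i j)) ⟩
      f (single i) * (f ⋆ one) (single j) + f (single j) * (f ⋆ one) (single i)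
        ≈⟨ +-cong (*-congˡ (⋆one-single j)) (*-congˡ (⋆one-single i)) ⟩
      f (single i) * f (single j) + f (single j) * f (single i) ∎

  -- The form v₁x₁ + ... + vₙxₙ. Once exponent 1 has been met, the factor `one α` keeps only the
  -- monomial whose remaining exponents are all zero.
  linear : ∀ {n} → (Fin n → Carrier) → Coefficients n
  linear v []                = 0#
  linear v (zero        ∷ α) = linear (v ∘ suc) α
  linear v (suc zero    ∷ α) = v zero * one α
  linear v (suc (suc _) ∷ α) = 0#

  linear-homogeneous : ∀ {n} (v : Fin n → Carrier) → Homogeneous 1 (linear v)
  linear-homogeneous v []                _     = ≈-refl
  linear-homogeneous v (zero        ∷ α) ∣α∣≢1 =
    linear-homogeneous (v ∘ suc) α ∣α∣≢1
  linear-homogeneous v (suc zero    ∷ α) ∣α∣≢1 =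
    zero-*ʳ _ (one-homogeneous α (∣α∣≢1 ∘ cong suc))
  linear-homogeneous v (suc (suc _) ∷ α) _     = ≈-refl

  linear-single : ∀ {n} (v : Fin n → Carrier) i → linear v (single i) ≈ v i
  linear-single {suc n} v zero    =
    ≈-trans (*-congˡ (reflexive (one-𝟎 n))) (*-identityʳ _)
  linear-single         v (suc i) = linear-single (v ∘ suc) i

  -- Isotropic families and Gram determinants.

  quad : ∀ {r} → (Fin r → Carrier) → Carrier
  quad u = sum λ k → u k * u k

  -- Twice the standard bilinear form, that is quad(u + v) - quad u - quad v, in the shape in which
  -- `^2-pair` delivers it.
  polar : ∀ {r} → (Fin r → Carrier) → (Fin r → Carrier) → Carrier
  polar u v = sum λ k → u k * v k + v k * u k

  -- Here `n` counts the vectors, one per variable, and `r` is their dimension, one coordinate per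
  -- square.
  record Isotropic {n r} (v : Fin n → Fin r → Carrier) : Set ℓ where
    field
      quad≈0  : ∀ i → quad (v i) ≈ 0#
      polar≉0 : ∀ {i j} → i ≢ j → ¬ (polar (v i) (v j) ≈ 0#)

  module _ {n r} {f : Fin r → Coefficients n} (hf : ∀ k → Homogeneous 1 (f k))
    where

    sum^2-homogeneous : Homogeneous 2 (sumˢ λ k → f k ^ 2)
    sum^2-homogeneous α ∣α∣≢2 = ≈-trans
      (reflexive (sumˢ-pointwise (λ k → f k ^ 2) α))
      (sum-zero λ k → ^2-homogeneous (hf k) α ∣α∣≢2)

    sum^2-pair-diagonal : ∀ i →
      sumˢ (λ k → f k ^ 2) (pair i i) ≈ quad λ k → f k (single i)
    sum^2-pair-diagonal i = ≈-trans
      (reflexive (sumˢ-pointwise (λ k → f k ^ 2) (pair i i)))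
      (sum-cong-≋ λ k → ^2-pair-diagonal (hf k) i)

    sum^2-pair : ∀ {i j} → i ≢ j → sumˢ (λ k → f k ^ 2) (pair i j) ≈
      polar (λ k → f k (single i)) (λ k → f k (single j))
    sum^2-pair {i} {j} i≢j = ≈-trans
      (reflexive (sumˢ-pointwise (λ k → f k ^ 2) (pair i j)))
      (sum-cong-≋ λ k → ^2-pair (hf k) i≢j)

  -- The vanishing of the Gram determinants of 2 vectors in K¹ and 3 vectors
  -- in K²; terms are moved so that no subtraction occurs.
  gram₂ : ∀ (u v : Fin 1 → Carrier) →
    polar u v * polar u v ≈
    (quad u * quad v + quad u * quad v) + (quad u * quad v + quad u * quad v)
  gram₂ u v = solve 2 (λ a b →
    let p = (a :* b :+ b :* a) :+ con 0
        q = (a :* a :+ con 0) :* (b :* b :+ con 0)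
    in p :* p := (q :+ q) :+ (q :+ q)) ≈-refl (u zero) (v zero)

  gram₃ : ∀ (u v w : Fin 2 → Carrier) →
    let q = quad u * quad v * quad w in
    polar u v * polar v w * polar u w + ((q + q) + (q + q)) ≈
    quad u * (polar v w * polar v w) + quad v * (polar u w * polar u w)
      + quad w * (polar u v * polar u v)
  gram₃ u v w = solve 6 (λ a a′ b b′ c c′ →
    let A = a :* a :+ (a′ :* a′ :+ con 0)
        B = b :* b :+ (b′ :* b′ :+ con 0)
        C = c :* c :+ (c′ :* c′ :+ con 0)
        P = (a :* b :+ b :* a) :+ ((a′ :* b′ :+ b′ :* a′) :+ con 0)
        Q = (b :* c :+ c :* b) :+ ((b′ :* c′ :+ c′ :* b′) :+ con 0)
        R = (a :* c :+ c :* a) :+ ((a′ :* c′ :+ c′ :* a′) :+ con 0)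
        q = A :* B :* C
    in P :* Q :* R :+ ((q :+ q) :+ (q :+ q)) :=
       A :* (Q :* Q) :+ B :* (R :* R) :+ C :* (P :* P))
    ≈-refl (u zero) (u (suc zero)) (v zero) (v (suc zero))
      (w zero) (w (suc zero))

  module _ (domain : ∀ {x y} → ¬ (x ≈ 0#) → ¬ (y ≈ 0#) → ¬ (x * y ≈ 0#)) where

    -- In dimension 0, `polar` is an empty sum. In dimension 1, `gram₂` makes the square of `polar`
    -- four times a product of vanishing `quad` values, against `domain`.
    2≤isotropic : ∀ {n r} {v : Fin (2 ℕ.+ n) → Fin r → Carrier} →
                  Isotropic v → 2 ℕ.≤ r
    2≤isotropic {r = zero} iso =
      contradiction ≈-refl (Isotropic.polar≉0 iso {zero} {suc zero} λ ())
    2≤isotropic {r = suc zero} {v} iso = contradiction p²≈0 (domain p≉0 p≉0)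
      where
      open Isotropic iso
      p≉0 : ¬ (polar (v zero) (v (suc zero)) ≈ 0#)
      p≉0 = polar≉0 λ ()
      q≈0 : quad (v zero) * quad (v (suc zero)) ≈ 0#
      q≈0 = zero-*ˡ _ (quad≈0 zero)
      p²≈0 = ≈-trans (gram₂ (v zero) (v (suc zero)))
        (zero-+ (zero-+ q≈0 q≈0) (zero-+ q≈0 q≈0))
    2≤isotropic {r = suc (suc r)} _ = s≤s (s≤s z≤n)

    -- In dimension 2, every term of `gram₃` except the product of three `polar` values contains a
    -- `quad` factor, so that product vanishes, against `domain`.
    3≤isotropic : ∀ {n r} {v : Fin (3 ℕ.+ n) → Fin r → Carrier} →
                  Isotropic v → 3 ℕ.≤ r
    3≤isotropic {r = zero}          iso with () ← 2≤isotropic iso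
    3≤isotropic {r = suc zero}      iso with s≤s () ← 2≤isotropic iso
    3≤isotropic {r = suc (suc zero)} {v} iso = contradiction pqr≈0
      (domain (domain (polar≉0 λ ()) (polar≉0 λ ())) (polar≉0 λ ()))
      where
      open Isotropic iso
      u₀ = v zero
      u₁ = v (suc zero)
      u₂ = v (suc (suc zero))
      q≈0 : quad u₀ * quad u₁ * quad u₂ ≈ 0#
      q≈0 = zero-*ʳ _ (quad≈0 (suc (suc zero)))
      pqr≈0 : polar u₀ u₁ * polar u₁ u₂ * polar u₀ u₂ ≈ 0#
      pqr≈0 = begin
        polar u₀ u₁ * polar u₁ u₂ * polar u₀ u₂
          ≈⟨ +-identityʳ _ ⟨
        polar u₀ u₁ * polar u₁ u₂ * polar u₀ u₂ + 0#
          ≈⟨ +-congˡ (zero-+ (zero-+ q≈0 q≈0) (zero-+ q≈0 q≈0)) ⟨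
        _ ≈⟨ gram₃ u₀ u₁ u₂ ⟩
        _ ≈⟨ zero-+ (zero-+ (zero-*ˡ _ (quad≈0 zero))
                            (zero-*ˡ _ (quad≈0 (suc zero))))
                    (zero-*ˡ _ (quad≈0 (suc (suc zero)))) ⟩
        0# ∎
    3≤isotropic {r = suc (suc (suc r))} _ = s≤s (s≤s (s≤s z≤n))

-- Vanishing and apartness of real numbers.

x-0≡x : ∀ x → x ℚ.- 0ℚ ≡ x
x-0≡x = ℚ.+-identityʳ

≈0⇒small : ∀ {x} → x ≈ℝ fromℚ 0ℚ → ∀ ε → 0ℚ ℚ.< ε →
           ∃ λ N → ∀ m → N ℕ.≤ m → ∣ seq x m ∣ ℚ.< ε
≈0⇒small {x} x≈0 ε 0<ε with N , small ← seq-∼ x≈0 ε 0<ε =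
  N , λ m N≤m →
    subst (λ t → ∣ t ∣ ℚ.< ε) (x-0≡x (seq x m)) (small m m N≤m N≤m)

small⇒≈0 : ∀ {x} → (∀ ε → 0ℚ ℚ.< ε →
             ∃ λ N → ∀ m → N ℕ.≤ m → ∣ seq x m ∣ ℚ.< ε) →
           x ≈ℝ fromℚ 0ℚ
small⇒≈0 {x} small = mk≈ λ ε 0<ε → let N , smallₙ = small ε 0<ε in
  N , λ m _ N≤m _ →
    subst (λ t → ∣ t ∣ ℚ.< ε) (sym (x-0≡x (seq x m))) (smallₙ m N≤m)

-- A positive form of nonvanishing. The negation of `x ≈ℝ fromℚ 0ℚ` does not by itself hand over a
-- bound δ to compute with.
Apart₀ : ℝ → Set
Apart₀ x = ∃ λ δ → 0ℚ ℚ.< δ × ∃ λ N → ∀ m → N ℕ.≤ m → δ ℚ.≤ ∣ seq x m ∣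

∣p∣≤∣p-q∣+∣q∣ : ∀ p q → ∣ p ∣ ℚ.≤ ∣ p ℚ.- q ∣ ℚ.+ ∣ q ∣
∣p∣≤∣p-q∣+∣q∣ p q = subst (λ t → ∣ t ∣ ℚ.≤ ∣ p ℚ.- q ∣ ℚ.+ ∣ q ∣)
  (solve 2 (λ p q → (p :- q) :+ q := p) refl p q)
  (ℚ.∣p+q∣≤∣p∣+∣q∣ (p ℚ.- q) q)
  where open +-*-Solver

-- Comparing one late term of x with 2ε/3 decides between ∣x∣ < ε and
-- ε/3 ≤ ∣x∣ from there on.
¬apart₀⇒≈0 : ∀ {x} → ¬ Apart₀ x → x ≈ℝ fromℚ 0ℚ
¬apart₀⇒≈0 {x} ¬apart = small⇒≈0 λ ε 0<ε →
  let δ   = ⅓ ℚ.* ε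
      0<δ = subst (ℚ._< δ) (ℚ.*-zeroʳ ⅓) (ℚ.*-monoʳ-<-pos ⅓ 0<ε)
      N , close = cauchy x δ 0<δ
  in N , λ m N≤m → subst (∣ seq x m ∣ ℚ.<_) (δ+[δ+δ]≡ε ε)
       (bound 0<δ N close m N≤m)
  where
  open +-*-Solver
  ⅓ = ℤ.+ 1 ℚ./ 3

  δ+[δ+δ]≡ε : ∀ ε → ⅓ ℚ.* ε ℚ.+ (⅓ ℚ.* ε ℚ.+ ⅓ ℚ.* ε) ≡ ε
  δ+[δ+δ]≡ε = solve 1
    (λ ε → con ⅓ :* ε :+ (con ⅓ :* ε :+ con ⅓ :* ε) := ε) refl

  bound : ∀ {δ} → 0ℚ ℚ.< δ → ∀ N →
          (∀ m n → N ℕ.≤ m → N ℕ.≤ n → ∣ seq x m ℚ.- seq x n ∣ ℚ.< δ) →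
          ∀ m → N ℕ.≤ m → ∣ seq x m ∣ ℚ.< δ ℚ.+ (δ ℚ.+ δ)
  bound {δ} 0<δ N close m N≤m with ∣ seq x N ∣ ℚ.<? δ ℚ.+ δ
  ... | yes ∣xN∣<2δ = ℚ.≤-<-trans (∣p∣≤∣p-q∣+∣q∣ (seq x m) (seq x N))
          (ℚ.+-mono-< (close m N N≤m ℕ.≤-refl) ∣xN∣<2δ)
  ... | no  ∣xN∣≮2δ = contradiction (δ , 0<δ , N , large) ¬apart
    where
    large : ∀ n → N ℕ.≤ n → δ ℚ.≤ ∣ seq x n ∣
    large n N≤n = ℚ.≮⇒≥ λ ∣xn∣<δ → ∣xN∣≮2δ
      (ℚ.≤-<-trans (∣p∣≤∣p-q∣+∣q∣ (seq x N) (seq x n))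
        (ℚ.+-mono-< (close N n ℕ.≤-refl N≤n) ∣xn∣<δ))

apart₀⇒≉0 : ∀ {x} → Apart₀ x → ¬ (x ≈ℝ fromℚ 0ℚ)
apart₀⇒≉0 (δ , 0<δ , N , large) x≈0 with M , small ← ≈0⇒small x≈0 δ 0<δ =
  ℚ.<-irrefl refl (ℚ.<-≤-trans
    (small (M ℕ.⊔ N) (ℕ.m≤m⊔n M N)) (large (M ℕ.⊔ N) (ℕ.m≤n⊔m M N)))

apart₀-cancelˡ : ∀ {x y} → Apart₀ x → x *ℝ y ≈ℝ fromℚ 0ℚ → y ≈ℝ fromℚ 0ℚ
apart₀-cancelˡ {x} {y} (δ , 0<δ , N , large) xy≈0 = small⇒≈0 λ ε 0<ε →
  -- The tolerance is δε because eventually δ|y| ≤ |xy| < δε, after which δ cancels.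
  let M , small = ≈0⇒small xy≈0 (δ ℚ.* ε) (0<δ*ε ε 0<ε)
  in M ℕ.⊔ N , λ m M⊔N≤m →
    ℚ.*-cancelˡ-<-nonNeg δ {{ℚ.nonNegative (ℚ.<⇒≤ 0<δ)}}
      (ℚ.≤-<-trans
        (ℚ.*-monoʳ-≤-nonNeg ∣ seq y m ∣ {{ℚ.nonNegative (ℚ.0≤∣p∣ (seq y m))}}
          (large m (ℕ.m⊔n≤o⇒n≤o M N M⊔N≤m)))
        (subst (ℚ._< δ ℚ.* ε) (ℚ.∣p*q∣≡∣p∣*∣q∣ (seq x m) (seq y m))
          (small m (ℕ.m⊔n≤o⇒m≤o M N M⊔N≤m))))
  where
  0<δ*ε : ∀ ε → 0ℚ ℚ.< ε → 0ℚ ℚ.< δ ℚ.* ε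
  0<δ*ε ε 0<ε = subst (ℚ._< δ ℚ.* ε) (ℚ.*-zeroʳ δ)
    (ℚ.*-monoʳ-<-pos δ {{ℚ.positive 0<δ}} 0<ε)

-- Being zero is equivalent to the negation of `Apart₀`, and negations are stable. This replaces
-- case distinctions on whether a real number is zero.
≈0-stable : ∀ {x} → ¬ ¬ (x ≈ℝ fromℚ 0ℚ) → x ≈ℝ fromℚ 0ℚ
≈0-stable ¬x≉0 = ¬apart₀⇒≈0 λ apart → ¬x≉0 (apart₀⇒≉0 apart)

-- Since `x` is only known to be nonzero, not apart from zero, the argument goes through stability:
-- if `y` were nonzero, `apart₀-cancelˡ` would prevent `x` from being apart from zero, so `x` would
-- be zero.
≉0-cancelˡ : ∀ {x y} → ¬ (x ≈ℝ fromℚ 0ℚ) → x *ℝ y ≈ℝ fromℚ 0ℚ →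
             y ≈ℝ fromℚ 0ℚ
≉0-cancelˡ x≉0 xy≈0 = ≈0-stable λ y≉0 →
  x≉0 (¬apart₀⇒≈0 λ apart → y≉0 (apart₀-cancelˡ apart xy≈0))

fromℚ-injective₀ : ∀ {q} → fromℚ q ≈ℝ fromℚ 0ℚ → q ≡ 0ℚ
fromℚ-injective₀ {q} q≈0 with q ℚ.≟ 0ℚ
... | yes q≡0 = q≡0
... | no  q≢0 = contradiction q≈0 (apart₀⇒≉0
  (∣ q ∣ , 0<∣q∣ , 0 , λ _ _ → ℚ.≤-refl))
  where
  0<∣q∣ : 0ℚ ℚ.< ∣ q ∣
  0<∣q∣ = ℚ.≰⇒> λ ∣q∣≤0 →
    q≢0 (ℚ.∣p∣≡0⇒p≡0 q (ℚ.≤-antisym ∣q∣≤0 (ℚ.0≤∣p∣ q)))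

0≤p*p : ∀ p → 0ℚ ℚ.≤ p ℚ.* p
0≤p*p p with ℚ.≤-total 0ℚ p
... | inj₁ 0≤p = ℚ.nonNegative⁻¹ (p ℚ.* p)
  {{ℚ.nonNeg*nonNeg⇒nonNeg p {{ℚ.nonNegative 0≤p}} p {{ℚ.nonNegative 0≤p}}}}
... | inj₂ p≤0 = ℚ.nonNegative⁻¹ (p ℚ.* p)
  {{ℚ.nonPos*nonPos⇒nonPos p {{ℚ.nonPositive p≤0}} p {{ℚ.nonPositive p≤0}}}}

∣p∣*∣p∣≤∣p*p+q*q∣ : ∀ p q → ∣ p ∣ ℚ.* ∣ p ∣ ℚ.≤ ∣ p ℚ.* p ℚ.+ q ℚ.* q ∣
∣p∣*∣p∣≤∣p*p+q*q∣ p q = begin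
  ∣ p ∣ ℚ.* ∣ p ∣             ≡⟨ ℚ.∣p*q∣≡∣p∣*∣q∣ p p ⟨
  ∣ p ℚ.* p ∣                 ≡⟨ ℚ.0≤p⇒∣p∣≡p (0≤p*p p) ⟩
  p ℚ.* p                     ≡⟨ ℚ.+-identityʳ (p ℚ.* p) ⟨
  p ℚ.* p ℚ.+ 0ℚ              ≤⟨ ℚ.+-monoʳ-≤ (p ℚ.* p) (0≤p*p q) ⟩
  p ℚ.* p ℚ.+ q ℚ.* q         ≡⟨ ℚ.0≤p⇒∣p∣≡p (ℚ.+-mono-≤ (0≤p*p p) (0≤p*p q)) ⟨
  ∣ p ℚ.* p ℚ.+ q ℚ.* q ∣     ∎
  where open ℚ.≤-Reasoning

-- If eventually |x| ≥ δ, then eventually x² + y² ≥ δ², so the sum of squares is apart from zero as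
-- well.
x*x+y*y≈0⇒x≈0 : ∀ {x y} → x *ℝ x +ℝ y *ℝ y ≈ℝ fromℚ 0ℚ → x ≈ℝ fromℚ 0ℚ
x*x+y*y≈0⇒x≈0 {x} {y} x²+y²≈0 = ¬apart₀⇒≈0 λ (δ , 0<δ , N , large) →
  apart₀⇒≉0 {x *ℝ x +ℝ y *ℝ y}
    (δ ℚ.* δ
    , subst (ℚ._< δ ℚ.* δ) (ℚ.*-zeroʳ δ)
        (ℚ.*-monoʳ-<-pos δ {{ℚ.positive 0<δ}} 0<δ)
    , N
    , λ m N≤m → ℚ.≤-trans (square-mono (ℚ.<⇒≤ 0<δ) (large m N≤m))
        (∣p∣*∣p∣≤∣p*p+q*q∣ (seq x m) (seq y m)))
    x²+y²≈0
  where
  square-mono : ∀ {p q} → 0ℚ ℚ.≤ p → p ℚ.≤ q → p ℚ.* p ℚ.≤ q ℚ.* q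
  square-mono {p} {q} 0≤p p≤q = ℚ.≤-trans
    (ℚ.*-monoʳ-≤-nonNeg p {{ℚ.nonNegative 0≤p}} p≤q)
    (ℚ.*-monoˡ-≤-nonNeg q {{ℚ.nonNegative (ℚ.≤-trans 0≤p p≤q)}} p≤q)

-- Absence of zero divisors in the complex numbers.

private
  module ℝᵣ = CommutativeRing ℝ-commutativeRing
  module ℂᵣ = CommutativeRing ℂ-commutativeRing

-- `HasMultilinearSupport` speaks only of nonzero coefficients; off the support it yields "not
-- nonzero", from which vanishing is recovered here.
≈ℂ0-stable : ∀ {z} → ¬ ¬ (z ≈ℂ 0ℂ) → z ≈ℂ 0ℂ
≈ℂ0-stable ¬z≉0 =
  ≈0-stable (λ re≉0 → ¬z≉0 λ z≈0 → re≉0 (re-≈ z≈0)) ,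
  ≈0-stable (λ im≉0 → ¬z≉0 λ z≈0 → im≉0 (im-≈ z≈0))

-- Multiplying z * w ≈ 0 by the conjugate of z reduces to a real factor.
ℂ-domain : ∀ {z w} → ¬ (z ≈ℂ 0ℂ) → ¬ (w ≈ℂ 0ℂ) → ¬ (z *ℂ w ≈ℂ 0ℂ)
ℂ-domain {a +i b} {c +i d} z≉0 w≉0 (re≈0 , im≈0) =
  w≉0 (≉0-cancelˡ norm≉0 norm*re≈0 , ≉0-cancelˡ norm≉0 norm*im≈0)
  where
  open +-*-Solver using (solve; _:+_; _:-_; _:*_; _:=_)
  open SeriesProperties ℝ-commutativeRing using (zero-*ʳ; zero-+)

  norm : ℝ
  norm = a *ℝ a +ℝ b *ℝ b

  norm≉0 : ¬ (norm ≈ℝ fromℚ 0ℚ)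
  norm≉0 norm≈0 = z≉0
    ( x*x+y*y≈0⇒x≈0 norm≈0
    , x*x+y*y≈0⇒x≈0
        (ℝᵣ.trans (ℝᵣ.+-comm (b *ℝ b) (a *ℝ a)) norm≈0))

  norm*re≈0 : norm *ℝ c ≈ℝ fromℚ 0ℚ
  norm*re≈0 = ℝᵣ.trans
    (≗⇒≈ℝ λ n → solve 4 (λ a b c d →
      (a :* a :+ b :* b) :* c :=
      a :* (a :* c :- b :* d) :+ b :* (a :* d :+ b :* c))
      refl (seq a n) (seq b n) (seq c n) (seq d n))
    (zero-+ (zero-*ʳ a re≈0) (zero-*ʳ b im≈0))

  norm*im≈0 : norm *ℝ d ≈ℝ fromℚ 0ℚ
  norm*im≈0 = ℝᵣ.trans
    (≗⇒≈ℝ λ n → solve 4 (λ a b c d →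
      (a :* a :+ b :* b) :* d :=
      a :* (a :* d :+ b :* c) :- b :* (a :* c :- b :* d))
      refl (seq a n) (seq b n) (seq c n) (seq d n))
    (zero-+ (zero-*ʳ a im≈0)
      (ℝᵣ.trans (ℝᵣ.-‿cong (zero-*ʳ b re≈0)) (≗⇒≈ℝ λ _ → refl)))

-- Quadrics with multilinear support and isotropic families.

open MonoidSum ℂᵣ.+-monoid using (sum-cong-≋)
open SeriesProperties ℂ-commutativeRing

isSumOfSquares⇒isotropic : ∀ {n r} {g : Form n 2} → HasMultilinearSupport g →
  IsSumOfPowers g r → ∃ λ (v : Fin n → Fin r → ℂ) → Isotropic v
isSumOfSquares⇒isotropic {g = g} support (l , g≈) =
  (λ i k → coeff (l k) (single i)) , record
  { quad≈0 = λ i → ℂᵣ.trans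
      (ℂᵣ.sym (ℂᵣ.trans (g≈ (pair i i)) (sum^2-pair-diagonal l-homogeneous i)))
      (≈ℂ0-stable λ g≉0 → pair-diagonal≰1 i
        (proj₁ (Equivalence.to (support (pair i i)) g≉0)))
  ; polar≉0 = λ {i} {j} i≢j polar≈0 →
      Equivalence.from (support (pair i j)) (pair≤1 i≢j , sum-pair i j)
        (ℂᵣ.trans (ℂᵣ.trans (g≈ (pair i j)) (sum^2-pair l-homogeneous i≢j))
          polar≈0)
  }
  where
  l-homogeneous = λ k → homogeneous (l k)

module _ {n r} {v : Fin n → Fin r → ℂ} (isotropic : Isotropic v) where

  open Isotropic isotropic

  private

    l : Fin r → LinearForm n
    l k = form (linear λ i → v i k) (linear-homogeneous λ i → v i k)

    l-single : ∀ i k → coeff (l k) (single i) ≈ℂ v i k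
    l-single i k = linear-single (λ i → v i k) i

    g : Form n 2
    g = form (sumˢ λ k → coeff (l k) ^ 2)
             (sum^2-homogeneous λ k → homogeneous (l k))

    g-diagonal : ∀ i → coeff g (pair i i) ≈ℂ 0ℂ
    g-diagonal i = ℂᵣ.trans (sum^2-pair-diagonal (λ k → homogeneous (l k)) i)
      (ℂᵣ.trans (sum-cong-≋ λ k → ℂᵣ.*-cong (l-single i k) (l-single i k))
        (quad≈0 i))

    g-pair : ∀ {i j} → i ≢ j → ¬ (coeff g (pair i j) ≈ℂ 0ℂ)
    g-pair {i} {j} i≢j g≈0 = polar≉0 i≢j (ℂᵣ.trans
      (ℂᵣ.sym (ℂᵣ.trans (sum^2-pair (λ k → homogeneous (l k)) i≢j)
        (sum-cong-≋ λ k → ℂᵣ.+-cong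
          (ℂᵣ.*-cong (l-single i k) (l-single j k))
          (ℂᵣ.*-cong (l-single j k) (l-single i k)))))
      g≈0)

    g≉0⇒multilinear : ∀ α → ¬ (coeff g α ≈ℂ 0ℂ) → IsMultilinear 2 α
    g≉0⇒multilinear α g≉0 with Vec.sum α ℕ.≟ 2
    ... | no  ∣α∣≢2 = contradiction (homogeneous g α ∣α∣≢2) g≉0
    ... | yes ∣α∣≡2 with i , j , refl ← sum≡2⇒pair α ∣α∣≡2 with i Fin.≟ j
    ...   | yes refl = contradiction (g-diagonal i) g≉0
    ...   | no  i≢j  = pair≤1 i≢j , sum-pair i j

    multilinear⇒g≉0 : ∀ α → IsMultilinear 2 α → ¬ (coeff g α ≈ℂ 0ℂ)
    multilinear⇒g≉0 α (α≤1 , ∣α∣≡2)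
      with i , j , refl ← sum≡2⇒pair α ∣α∣≡2 with i Fin.≟ j
    ... | yes refl = contradiction α≤1 (pair-diagonal≰1 i)
    ... | no  i≢j  = g-pair i≢j

    g-support : HasMultilinearSupport g
    g-support α = mk⇔ (g≉0⇒multilinear α) (multilinear⇒g≉0 α)

  -- One bound settles both minima in `IsA`: a form with multilinear support that is a sum of s
  -- squares yields an isotropic family in dimension s, hence r ≤ s. This applies to the constructed
  -- `g`, giving its rank, and to every competitor `h`.
  isotropic⇒IsA : (∀ {s} {w : Fin n → Fin s → ℂ} → Isotropic w → r ℕ.≤ s) →
                  IsA n 2 r
  isotropic⇒IsA minimal =
    (g , g-support , (l , λ _ → ℂᵣ.refl) , λ s → r≤ {g} g-support) ,
    λ s (h , support , sum , _) → r≤ {h} support sum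
    where
    r≤ : ∀ {h s} → HasMultilinearSupport h → IsSumOfPowers h s → r ℕ.≤ s
    r≤ {h} support sum =
      minimal (proj₂ (isSumOfSquares⇒isotropic {g = h} support sum))

-- Isotropic families in dimensions two, three and zero.

gauss : ℚ → ℚ → ℂ
gauss p q = fromℚ p +i fromℚ q

-- The vectors (1, i) and (1, -i), read off from (x₁ + x₂)² + (i x₁ - i x₂)² = 4 x₁ x₂.
conjugates : Fin 2 → Fin 2 → ℂ
conjugates _          zero       = gauss 1ℚ 0ℚ
conjugates zero       (suc zero) = gauss 0ℚ 1ℚ
conjugates (suc zero) (suc zero) = gauss 0ℚ (ℚ.- 1ℚ)

conjugates-isotropic : Isotropic conjugates
conjugates-isotropic = record
  { quad≈0  = λ
      { zero       → (≗⇒≈ℝ λ _ → refl) , (≗⇒≈ℝ λ _ → refl)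
      ; (suc zero) → (≗⇒≈ℝ λ _ → refl) , (≗⇒≈ℝ λ _ → refl)
      }
  ; polar≉0 = λ
      { {zero}     {zero}     i≢j _ → i≢j refl
      ; {zero}     {suc zero} _ (re≈0 , _) →
          4≉0 (ℝᵣ.trans (≗⇒≈ℝ λ _ → refl) re≈0)
      ; {suc zero} {zero}     _ (re≈0 , _) →
          4≉0 (ℝᵣ.trans (≗⇒≈ℝ λ _ → refl) re≈0)
      ; {suc zero} {suc zero} i≢j _ → i≢j refl
      }
  }
  where
  4≉0 : ¬ (fromℚ (ℤ.+ 4 ℚ./ 1) ≈ℝ fromℚ 0ℚ)
  4≉0 4≈0 with () ← fromℚ-injective₀ 4≈0

-- The rational parametrisation of the circle, (1 - t²)² + (2t)² = (1 + t²)²; the factor i in the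
-- last coordinate turns this identity into isotropy.
conic : ℚ → Fin 3 → ℂ
conic t zero             = gauss (1ℚ ℚ.- t ℚ.* t) 0ℚ
conic t (suc zero)       = gauss (t ℚ.+ t) 0ℚ
conic t (suc (suc zero)) = gauss 0ℚ (1ℚ ℚ.+ t ℚ.* t)

module _ where

  open +-*-Solver

  private

    -4ℚ : ℚ
    -4ℚ = ℤ.-[1+ 3 ] ℚ./ 1

    -- The operations of ℂ on pairs of polynomials over ℚ, for the solver.
    _⊕_ _⊗_ : ∀ {n} (z w : Polynomial n × Polynomial n) →
              Polynomial n × Polynomial n
    (a , b) ⊕ (c , d) = a :+ c , b :+ d
    (a , b) ⊗ (c , d) = a :* c :- b :* d , a :* d :+ b :* c

    sum₃ : ∀ {n} → (Fin 3 → Polynomial n × Polynomial n) →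
           Polynomial n × Polynomial n
    sum₃ f = f zero ⊕ (f (suc zero) ⊕ (f (suc (suc zero)) ⊕ (con 0ℚ , con 0ℚ)))

    conicᵖ : ∀ {n} → Polynomial n → Fin 3 → Polynomial n × Polynomial n
    conicᵖ t zero             = con 1ℚ :- t :* t , con 0ℚ
    conicᵖ t (suc zero)       = t :+ t , con 0ℚ
    conicᵖ t (suc (suc zero)) = con 0ℚ , con 1ℚ :+ t :* t

    quadᵖ : ∀ {n} → Polynomial n → Polynomial n × Polynomial n
    quadᵖ t = sum₃ λ k → conicᵖ t k ⊗ conicᵖ t k

    polarᵖ : ∀ {n} → (s t : Polynomial n) → Polynomial n × Polynomial n
    polarᵖ s t = sum₃ λ k →
      (conicᵖ s k ⊗ conicᵖ t k) ⊕ (conicᵖ t k ⊗ conicᵖ s k)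

  quad-conic : ∀ t → quad (conic t) ≈ℂ 0ℂ
  quad-conic t =
    (≗⇒≈ℝ λ _ → solve 1 (λ t → proj₁ (quadᵖ t) := con 0ℚ) refl t) ,
    (≗⇒≈ℝ λ _ → solve 1 (λ t → proj₂ (quadᵖ t) := con 0ℚ) refl t)

  -- The constant is -4 because `polar` doubles the bilinear product -2(s - t)². A nonzero real part
  -- already keeps a complex number from vanishing.
  polar-conic : ∀ s t → let d = fromℚ (s ℚ.- t) in
                re (polar (conic s) (conic t)) ≈ℝ fromℚ -4ℚ *ℝ (d *ℝ d)
  polar-conic s t = ≗⇒≈ℝ λ _ → solve 2 (λ s t →
    proj₁ (polarᵖ s t) := con -4ℚ :* ((s :- t) :* (s :- t))) refl s t

  polar-conic≉0 : ∀ {s t} → s ≢ t → ¬ (polar (conic s) (conic t) ≈ℂ 0ℂ)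
  polar-conic≉0 {s} {t} s≢t (re≈0 , _) =
    d≉0 (≉0-cancelˡ d≉0 (≉0-cancelˡ -4≉0
      (ℝᵣ.trans (ℝᵣ.sym (polar-conic s t)) re≈0)))
    where
    d≉0 : ¬ (fromℚ (s ℚ.- t) ≈ℝ fromℚ 0ℚ)
    d≉0 d≈0 = s≢t (x∙y⁻¹≈ε⇒x≈y s t (fromℚ-injective₀ d≈0))
      where open GroupProperties ℚ.+-0-group

    -4≉0 : ¬ (fromℚ -4ℚ ≈ℝ fromℚ 0ℚ)
    -4≉0 -4≈0 with () ← fromℚ-injective₀ -4≈0

toℚ-injective : ∀ {k l} → toℚ k ≡ toℚ l → k ≡ l
toℚ-injective {k} {l} eq
  -- `toℚ k` is by definition `fromℚᵘ` of the fraction k/1; `mkℚᵘ` stores the denominator minus one,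
  -- hence the 0.
  with *≡* k*1≡l*1 ← ℚ.fromℚᵘ-injective {mkℚᵘ (ℤ.+ k) 0} {mkℚᵘ (ℤ.+ l) 0} eq =
  ℤ.+-injective (trans (sym (ℤ.*-identityʳ (ℤ.+ k)))
    (trans k*1≡l*1 (ℤ.*-identityʳ (ℤ.+ l))))

conic-isotropic : ∀ n → Isotropic λ (i : Fin n) → conic (toℚ (toℕ i))
conic-isotropic n = record
  { quad≈0  = λ i → quad-conic (toℚ (toℕ i))
  ; polar≉0 = λ i≢j → polar-conic≉0 λ eq →
      i≢j (Fin.toℕ-injective (toℚ-injective eq))
  }

-- With at most one variable there is no multilinear monomial of degree 2: the condition on pairs is
-- vacuous, and the form is the empty sum of squares.
trivial-isotropic : ∀ {n} → n ℕ.≤ 1 → Isotropic {n} {0} λ _ ()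
trivial-isotropic n≤1 = record
  { quad≈0  = λ _ → ℂᵣ.refl
  ; polar≉0 = λ i≢j _ → i≢j (Fin≤1-irrelevant n≤1 _ _)
  }
  where
  Fin≤1-irrelevant : ∀ {n} → n ℕ.≤ 1 → (i j : Fin n) → i ≡ j
  Fin≤1-irrelevant (s≤s z≤n) zero zero = refl

-- The values of A(n, 2) and their limit.

A₂ : ℕ → ℕ
A₂ 0 = 0
A₂ 1 = 0
A₂ 2 = 2
A₂ (suc (suc (suc _))) = 3

A₂-correct : ∀ n → IsA n 2 (A₂ n)
A₂-correct 0 = isotropic⇒IsA (trivial-isotropic z≤n) λ _ → z≤n
A₂-correct 1 = isotropic⇒IsA (trivial-isotropic (s≤s z≤n)) λ _ → z≤n
A₂-correct 2 = isotropic⇒IsA conjugates-isotropic (2≤isotropic ℂ-domain)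
A₂-correct (suc (suc (suc n))) =
  isotropic⇒IsA (conic-isotropic (3 ℕ.+ n)) (3≤isotropic ℂ-domain)

A₂⟶3 : A₂ ⟶ 3
-- From n = 3 on the sequence is constant. Matching on the bound exposes this, the difference
-- computes to 0, and the hypothesis `0<ε` is the goal.
A₂⟶3 ε 0<ε = 3 , λ { _ (s≤s (s≤s (s≤s z≤n))) → 0<ε }

proposition33 : A[ℕ, 2 ]≡ 3
proposition33 = A₂ , A₂-correct , A₂⟶3
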